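{- Let $v$ be an integer such that either $v = 6k+1$ for some integer $k \geq 1$, or $v = 6k+4$ for some integer $k \geq 2$. If there exists a $\mathrm{TTS}(v)$ with a Hamiltonian $2$-BIG, then there exists a $\mathrm{TTS}(2v+2)$ with a Hamiltonian $2$-BIG.
   Context: A twofold triple system of order $v$, denoted $\mathrm{TTS}(v)$, is a pair $(V,\mathcal{B})$ where $V$ is a set of $v$ points and $\mathcal{B}$ is a collection of $3$-element subsets of $V$ (called blocks or triples; repeated blocks are permitted, i.e. $\mathcal{B}$ is a multiset) such that each $2$-element subset of $V$ is contained in exactly two blocks of $\mathcal{B}$, counted with multiplicity. The $2$-block-intersection graph ($2$-BIG) of $(V,\mathcal{B})$ is the graph whose vertices are the blocks in $\mathcal{B}$ (repeated blocks giving distinct vertices), where two vertices $B_1,B_2$ are adjacent if and only if $|B_1\cap B_2|=2$. A graph is Hamiltonian if it contains a Hamilton cycle (a cycle, of length at least $3$, through all vertices). -}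

module Defs where

open import Data.Fin.Base using (Fin; zero; suc; inject₁; fromℕ)
open import Data.Fin.Subset using (Subset; _∩_; ∣_∣)
open import Data.Fin.Subset.Properties using (_⊆?_; ∩-comm; ∩-idem)
open import Data.List.Base using (List; length; filter; lookup)
open import Data.List.Membership.Propositional.Properties using (∈-lookup)
open import Data.List.Relation.Unary.All as All using (All)
open import Data.Nat.Base using (ℕ; suc; _≤_)
open import Data.Product.Base using (Σ; ∃)
open import Function.Definitions using (Injective)
open import Relation.Binary.PropositionalEquality using (_≡_; sym; trans; cong)
open import Relation.Nullary.Negation.Core using (¬_)

-- The point set is Fin v.  The multiset of blocks is given by a list (the
-- order of which carries no meaning), so repeated blocks are allowed and are
-- counted with multiplicity.
record TTS (v : ℕ) : Set where
  field
    blocks   : List (Subset v)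
    triples  : All (λ B → ∣ B ∣ ≡ 3) blocks
    balanced : (P : Subset v) → ∣ P ∣ ≡ 2 → length (filter (P ⊆?_) blocks) ≡ 2

record SimpleGraph : Set₁ where
  field
    Vertex      : Set
    Adj         : Vertex → Vertex → Set
    symmetric   : ∀ {x y} → Adj x y → Adj y x
    irreflexive : ∀ {x} → ¬ Adj x x

-- The vertices are the positions in the list of blocks, so that repeated
-- blocks give distinct vertices.
2-BIG : ∀ {v} → TTS v → SimpleGraph
2-BIG {v} T = record
  { Vertex      = Fin (length blocks)
  ; Adj         = λ i j → ∣ block i ∩ block j ∣ ≡ 2
  ; symmetric   = λ {i} {j} p → trans (cong ∣_∣ (∩-comm (block j) (block i))) p
  ; irreflexive = λ {i} p → 3≢2 (trans (sym (size i)) (trans (cong ∣_∣ (sym (∩-idem (block i)))) p))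
  }
  where
  open TTS T

  block : Fin (length blocks) → Subset v
  block = lookup blocks

  size : ∀ i → ∣ block i ∣ ≡ 3
  size i = All.lookup triples (∈-lookup {xs = blocks} i)

  3≢2 : ¬ 3 ≡ 2
  3≢2 ()

-- A cycle of length suc n, visiting the distinct vertices
-- at zero, …, at (fromℕ n) and then returning to at zero.
record Cycle (G : SimpleGraph) : Set where
  open SimpleGraph G
  field
    n        : ℕ
    length≥3 : 3 ≤ suc n
    at       : Fin (suc n) → Vertex
    distinct : Injective _≡_ _≡_ at
    step     : (i : Fin n) → Adj (at (inject₁ i)) (at (suc i))
    close    : Adj (at (fromℕ n)) (at zero)

IsHamilton : (G : SimpleGraph) → Cycle G → Set
IsHamilton G C = (x : Vertex) → ∃ λ i → at i ≡ x
  where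
  open SimpleGraph G
  open Cycle C

Hamiltonian : SimpleGraph → Set
Hamiltonian G = Σ (Cycle G) (IsHamilton G)

{-# OPTIONS --safe #-}
-- For every odd t = 2s+1 ≥ 3 there is an explicit TTS(3t+1) with a Hamiltonian
-- 2-BIG, and 2v+2 has this form.  The points are ∞ and three copies (levels) of
-- ℤ/t.  Each point r of level i+1 is the apex of a fan over the zigzag path
-- r, r∓1, r±1, r∓2, r±2, … on level i; rotating this path covers every pair of
-- level i twice.  The fans are completed by the blocks {r₀, r₁, r₂} and by
-- blocks through ∞, and the last triangle of each fan is flipped, which makes
-- the fans over different levels adjacent.  A walk through one fan of each
-- level and three blocks through ∞ leads from {r₀, r₁, r₂} to the same block at
-- r+2; as t is odd, t such laps visit everything.  The blocks are listed in the
-- order of this tour, so the Hamilton cycle is the list itself.  It suffices to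
-- cover each pair at least twice: the number of blocks does the rest.
module Submission where

open import Defs
open import Data.Empty using (⊥-elim)
open import Data.Fin.Base using (Fin; zero; suc; toℕ; fromℕ; fromℕ<; inject₁; combine)
open import Data.Fin.Patterns using (0F; 1F; 2F)
import Data.Fin.Properties as Fin
open import Data.Fin.Properties using (_≟_; toℕ-fromℕ<; toℕ-injective; toℕ<n; combine-injective; combine-surjective)
open import Data.Fin.Subset using (Subset; inside; outside; ⊥; ⁅_⁆; _∈_; _∉_; _⊆_; _∩_; _∪_; ∣_∣)
open import Data.Fin.Subset.Properties using (_⊆?_; _∈?_; ∪-identityˡ; ∣⁅x⁆∣≡1; x∈⁅x⁆; x∈⁅y⁆⇒x≡y; x∈p∪q⁺; x∈p∪q⁻; x∈p∩q⁺; p∩q⊆p; p∩q⊆q; ∩-comm; p⊆q⇒∣p∣≤∣q∣; p⊂q⇒∣p∣<∣q∣)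
open import Data.Integer.Base as ℤ using (ℤ; +_; -[1+_]; -_; 0ℤ; 1ℤ; -1ℤ)
open import Data.Integer.DivMod using (_%ℕ_; _/ℕ_; n%ℕd<d; a≡a%ℕn+[a/ℕn]*n)
import Data.Integer.Properties as ℤ
open import Data.Integer.Tactic.RingSolver using () renaming (solve-∀ to solveℤ)
open import Data.List.Base as List using (List; []; _∷_; _++_; length; filter; lookup; reverse)
open import Data.List.Membership.Propositional using () renaming (_∈_ to _∈ₗ_)
open import Data.List.Membership.Propositional.Properties using (∈-++⁺ˡ; ∈-++⁺ʳ)
open import Data.List.Properties using (unfold-reverse; length-++; length-reverse; length-map)
open import Data.List.Relation.Unary.All using (All; []; _∷_)
open import Data.List.Relation.Unary.Any using (here; there)
open import Data.List.Relation.Unary.Any.Properties using (reverse⁺)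
open import Data.Nat.Base using (ℕ; zero; suc; _+_; _*_; _∸_; _≤_; _<_; z≤n; s≤s; s≤s⁻¹)
open import Data.Nat.Properties using (≤-refl; ≤-reflexive; ≤-trans; ≤-antisym; <⇒≤; ≤⇒≯; >⇒≢; ≰⇒>; _≤?_; 1+n≰n; m≤n+m; m≤m+n; m∸n≤m; m<n⇒0<n∸m; m+[n∸m]≡n; m≤n+o⇒m∸n≤o; m≤n⇒m<n∨m≡n; +-mono-≤; +-monoˡ-≤; +-monoʳ-≤; +-cancelˡ-≤; +-cancelʳ-≤; *-cancelʳ-≤; +-assoc; +-comm; +-suc; +-identityʳ; suc-injective; +-0-commutativeMonoid; +-*-semiring; module ≤-Reasoning)
open import Data.Nat.Tactic.RingSolver using (solve-∀)
open import Data.Product.Base using (Σ; ∃; _×_; _,_; proj₁; proj₂)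
open import Data.Sign.Base as Sign using (Sign; opposite)
open import Data.Sum.Base using (_⊎_; inj₁; inj₂)
open import Data.Vec.Base using ([]; _∷_; here; there)
open import Function.Base using (_∘_)
open import Relation.Binary.PropositionalEquality using (_≡_; _≢_; refl; sym; trans; cong; cong₂; subst; module ≡-Reasoning)
open import Relation.Nullary using (yes; no; contradiction)

open import Algebra.Properties.CommutativeMonoid.Sum +-0-commutativeMonoid using (sum; sum-cong-≗; ∑-distrib-+; sum-replicate-zero)
open import Algebra.Properties.Semiring.Sum +-*-semiring using (*-distribˡ-sum)

private
  variable
    n : ℕ
    A : Set

-- Subsets with two or three elements.

pair : Fin n → Fin n → Subset n
pair a b = ⁅ a ⁆ ∪ ⁅ b ⁆

triple : Fin n → Fin n → Fin n → Subset n
triple a b c = ⁅ a ⁆ ∪ pair b c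

∣⁅x⁆∪p∣ : (x : Fin n) (p : Subset n) → x ∉ p → ∣ ⁅ x ⁆ ∪ p ∣ ≡ suc ∣ p ∣
∣⁅x⁆∪p∣ zero    (inside ∷ p)  x∉p = contradiction here x∉p
∣⁅x⁆∪p∣ zero    (outside ∷ p) x∉p = cong (suc ∘ ∣_∣) (∪-identityˡ p)
∣⁅x⁆∪p∣ (suc x) (inside ∷ p)  x∉p = cong suc (∣⁅x⁆∪p∣ x p (x∉p ∘ there))
∣⁅x⁆∪p∣ (suc x) (outside ∷ p) x∉p = ∣⁅x⁆∪p∣ x p (x∉p ∘ there)

∣pair∣ : {a b : Fin n} → a ≢ b → ∣ pair a b ∣ ≡ 2
∣pair∣ {a = a} {b} a≢b = trans (∣⁅x⁆∪p∣ a ⁅ b ⁆ (a≢b ∘ x∈⁅y⁆⇒x≡y b)) (cong suc (∣⁅x⁆∣≡1 b))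

∈pair⁻ : {x a b : Fin n} → x ∈ pair a b → x ≡ a ⊎ x ≡ b
∈pair⁻ {a = a} {b} x∈ with x∈p∪q⁻ ⁅ a ⁆ ⁅ b ⁆ x∈
... | inj₁ x∈a = inj₁ (x∈⁅y⁆⇒x≡y a x∈a)
... | inj₂ x∈b = inj₂ (x∈⁅y⁆⇒x≡y b x∈b)

∣triple∣ : {a b c : Fin n} → a ≢ b → a ≢ c → b ≢ c → ∣ triple a b c ∣ ≡ 3
∣triple∣ {a = a} {b} {c} a≢b a≢c b≢c = trans (∣⁅x⁆∪p∣ a (pair b c) a∉) (cong suc (∣pair∣ b≢c))
  where
  a∉ : a ∉ pair b c
  a∉ a∈ with ∈pair⁻ a∈
  ... | inj₁ a≡b = a≢b a≡b
  ... | inj₂ a≡c = a≢c a≡c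

1st : {a b c : Fin n} → a ∈ triple a b c
1st {a = a} = x∈p∪q⁺ (inj₁ (x∈⁅x⁆ a))

2nd : {a b c : Fin n} → b ∈ triple a b c
2nd {b = b} = x∈p∪q⁺ (inj₂ (x∈p∪q⁺ (inj₁ (x∈⁅x⁆ b))))

3rd : {a b c : Fin n} → c ∈ triple a b c
3rd {c = c} = x∈p∪q⁺ (inj₂ (x∈p∪q⁺ (inj₂ (x∈⁅x⁆ c))))

∉triple : {x a b c : Fin n} → x ≢ a → x ≢ b → x ≢ c → x ∉ triple a b c
∉triple {a = a} {b} {c} x≢a x≢b x≢c x∈ with x∈p∪q⁻ ⁅ a ⁆ (pair b c) x∈
... | inj₁ x∈a = x≢a (x∈⁅y⁆⇒x≡y a x∈a)
... | inj₂ x∈bc with ∈pair⁻ x∈bc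
...   | inj₁ x≡b = x≢b x≡b
...   | inj₂ x≡c = x≢c x≡c

pair⊆ : {a b : Fin n} {B : Subset n} → a ∈ B → b ∈ B → pair a b ⊆ B
pair⊆ a∈B b∈B x∈ with ∈pair⁻ x∈
... | inj₁ refl = a∈B
... | inj₂ refl = b∈B

pair-elements : (P : Subset n) → ∣ P ∣ ≡ 2 → ∃ λ a → ∃ λ b → a ≢ b × P ≡ pair a b
pair-elements (outside ∷ P) ∣P∣≡2 with pair-elements P ∣P∣≡2
... | a , b , a≢b , refl = suc a , suc b , (λ { refl → a≢b refl }) , refl
pair-elements (inside ∷ P) ∣P∣≡2 with singleton P (suc-injective ∣P∣≡2)
  where
  empty : ∀ {n} (P : Subset n) → ∣ P ∣ ≡ 0 → P ≡ ⊥
  empty []            _     = refl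
  empty (outside ∷ P) ∣P∣≡0 = cong (outside ∷_) (empty P ∣P∣≡0)

  singleton : ∀ {n} (P : Subset n) → ∣ P ∣ ≡ 1 → ∃ λ b → P ≡ ⁅ b ⁆
  singleton (inside ∷ P)  ∣P∣≡1 = zero , cong (inside ∷_) (empty P (suc-injective ∣P∣≡1))
  singleton (outside ∷ P) ∣P∣≡1 with singleton P ∣P∣≡1
  ... | b , refl = suc b , refl
... | b , refl = zero , suc b , (λ ()) , cong (inside ∷_) (sym (∪-identityˡ ⁅ b ⁆))

-- Linked blocks, paths, and closed paths as Hamilton cycles.

record Linked (B C : Subset n) : Set where
  constructor linked
  field
    size₁  : ∣ B ∣ ≡ 3
    size₂  : ∣ C ∣ ≡ 3
    common : ∣ B ∩ C ∣ ≡ 2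

open Linked

linked-sym : {B C : Subset n} → Linked B C → Linked C B
linked-sym {B = B} {C} (linked b c bc) = linked c b (trans (cong ∣_∣ (∩-comm C B)) bc)

-- The common points `p` and `q` give the lower bound; the point `u` makes `B ∩ C` a proper subset
-- of the triple `B`, which gives the upper one.
linked⁺ : {B C : Subset n} (p q u : Fin n) → ∣ B ∣ ≡ 3 → ∣ C ∣ ≡ 3 →
          p ≢ q → p ∈ B → p ∈ C → q ∈ B → q ∈ C → u ∈ B → u ∉ C → Linked B C
linked⁺ {B = B} {C} p q u ∣B∣ ∣C∣ p≢q p∈B p∈C q∈B q∈C u∈B u∉C = linked ∣B∣ ∣C∣ (≤-antisym
  (s≤s⁻¹ (subst (∣ B ∩ C ∣ <_) ∣B∣ (p⊂q⇒∣p∣<∣q∣ (p∩q⊆p B C , u , u∈B , u∉C ∘ p∩q⊆q B C))))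
  (subst (_≤ ∣ B ∩ C ∣) (∣pair∣ p≢q) (p⊆q⇒∣p∣≤∣q∣ (pair⊆ (x∈p∩q⁺ (p∈B , p∈C)) (x∈p∩q⁺ (q∈B , q∈C))))))

data Path (R : A → A → Set) : A → A → List A → Set where
  [_] : ∀ x → Path R x x (x ∷ [])
  _∷_ : ∀ {x y z ys} → R x y → Path R y z ys → Path R x z (x ∷ ys)

infixr 5 _∷_

module _ {R : A → A → Set} where

  path-++ : ∀ {w x y z ws ys} → Path R w x ws → R x y → Path R y z ys → Path R w z (ws ++ ys)
  path-++ [ _ ]    r q = r ∷ q
  path-++ (r′ ∷ p) r q = r′ ∷ path-++ p r q

  path-reverse : (∀ {x y} → R x y → R y x) → ∀ {x y xs} → Path R x y xs → Path R y x (reverse xs)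
  path-reverse R-sym [ x ] = [ x ]
  path-reverse R-sym (_∷_ {x} {ys = ys} r p) =
    subst (Path R _ x) (sym (unfold-reverse x ys)) (path-++ (path-reverse R-sym p) (R-sym r) [ x ])

  path-start : ∀ {x y z zs} → Path R x y (z ∷ zs) → x ≡ z
  path-start [ _ ]   = refl
  path-start (_ ∷ _) = refl

  path-step : ∀ {x y z zs} → Path R x y (z ∷ zs) → (i : Fin (length zs)) → R (lookup (z ∷ zs) (inject₁ i)) (lookup zs i)
  path-step (r ∷ p@([ _ ])) zero    = r
  path-step (r ∷ p@(_ ∷ _)) zero    = r
  path-step (r ∷ p@(_ ∷ _)) (suc i) = path-step p i

  path-end : ∀ {x y z zs} → Path R x y (z ∷ zs) → lookup (z ∷ zs) (fromℕ (length zs)) ≡ y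
  path-end [ _ ]            = refl
  path-end (r ∷ p@([ _ ]))  = refl
  path-end (r ∷ p@(_ ∷ _))  = path-end p

path-map : {B : Set} {R : A → A → Set} {S : B → B → Set} (f : A → B) → (∀ {x y} → R x y → S (f x) (f y)) →
           ∀ {x y xs} → Path R x y xs → Path S (f x) (f y) (List.map f xs)
path-map f h [ x ]   = [ f x ]
path-map f h (r ∷ p) = h r ∷ path-map f h p

-- Each link records the sizes of its ends, so only the last block needs separate evidence.
path-sizes : ∀ {B C : Subset n} {Bs} → Path Linked B C Bs → ∣ C ∣ ≡ 3 → All (λ X → ∣ X ∣ ≡ 3) Bs
path-sizes [ _ ]   c = c ∷ []
path-sizes (r ∷ p) c = size₁ r ∷ path-sizes p c

Balanced : List (Subset n) → Set
Balanced {n} Bs = (P : Subset n) → ∣ P ∣ ≡ 2 → length (filter (P ⊆?_) Bs) ≡ 2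

-- The vertices of the 2-BIG are list positions. With the blocks listed in path order the cycle is
-- the identity map, so it is trivially injective and surjective.
closedPath⇒Hamiltonian : ∀ {B C : Subset n} {Bs} → Path Linked B C Bs → Linked C B → 3 ≤ length Bs →
                         Balanced Bs → Σ (TTS n) λ T → Hamiltonian (2-BIG T)
closedPath⇒Hamiltonian {C = C} {Bs = B ∷ Bs} p l 3≤ bal =
  record { blocks = B ∷ Bs ; triples = path-sizes p (size₁ l) ; balanced = bal } ,
  record
    { n        = length Bs
    ; length≥3 = 3≤
    ; at       = λ i → i
    ; distinct = λ eq → eq
    ; step     = λ i → common (path-step p i)
    ; close    = subst (λ X → ∣ X ∩ B ∣ ≡ 2) (sym (path-end p))
                   (subst (λ X → ∣ C ∩ X ∣ ≡ 2) (path-start p) (common l))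
    } ,
  λ i → i , refl

-- Double counting

sum-mono-≤ : {f g : Fin n → ℕ} → (∀ i → f i ≤ g i) → sum f ≤ sum g
sum-mono-≤ {zero}  f≤g = z≤n
sum-mono-≤ {suc n} f≤g = +-mono-≤ (f≤g zero) (sum-mono-≤ (f≤g ∘ suc))

sum-mono-rigid : {f g : Fin n → ℕ} → (∀ i → f i ≤ g i) → sum g ≤ sum f → ∀ i → f i ≡ g i
sum-mono-rigid {f = f} {g} f≤g Σg≤Σf zero    = ≤-antisym (f≤g zero)
  (+-cancelʳ-≤ (sum (g ∘ suc)) _ _ (≤-trans Σg≤Σf (+-monoʳ-≤ (f zero) (sum-mono-≤ (f≤g ∘ suc)))))
sum-mono-rigid {f = f} {g} f≤g Σg≤Σf (suc i) = sum-mono-rigid (f≤g ∘ suc)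
  (+-cancelˡ-≤ (g zero) _ _ (≤-trans Σg≤Σf (+-mono-≤ (f≤g zero) ≤-refl))) i

sum-const : ∀ n c → sum {n} (λ _ → c) ≡ n * c
sum-const zero    c = refl
sum-const (suc n) c = cong (λ k → c + k) (sum-const n c)

-- The lower bound for row `p` of `cover`: `m` is to be the number of blocks through `p`, and every
-- other point is met at least twice.
at-or-2 : Fin n → ℕ → Fin n → ℕ
at-or-2 p m q with p ≟ q
... | yes _ = m
... | no  _ = 2

-- The `2` added on the left avoids the subtraction in `m + (n - 1) * 2`.
sum-at-or-2 : (p : Fin n) (m : ℕ) → sum (at-or-2 p m) + 2 ≡ m + n * 2
sum-at-or-2 {suc n} zero    m = trans (cong (λ k → m + k + 2) (sum-const n 2)) (assoc m (n * 2))
  where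
  assoc : ∀ m k → m + k + 2 ≡ m + (2 + k)
  assoc = solve-∀
sum-at-or-2 {suc n} (suc p) m = trans (cong (λ k → 2 + k + 2) (sum-cong-≗ shift))
  (trans (cong (λ k → 2 + k) (sum-at-or-2 p m)) (swap m (n * 2)))
  where
  shift : ∀ q → at-or-2 (suc p) m (suc q) ≡ at-or-2 p m q
  shift q with p ≟ q
  ... | yes _ = refl
  ... | no  _ = refl

  swap : ∀ m k → 2 + (m + k) ≡ m + (2 + k)
  swap = solve-∀

χ : Subset n → Fin n → ℕ
χ B p with p ∈? B
... | yes _ = 1
... | no  _ = 0

χ-∈ : {B : Subset n} {p : Fin n} → p ∈ B → χ B p ≡ 1
χ-∈ {B = B} {p} p∈B with p ∈? B
... | yes _   = refl
... | no p∉B = contradiction p∈B p∉B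

χ-idem : (B : Subset n) (p : Fin n) → χ B p * χ B p ≡ χ B p
χ-idem B p with p ∈? B
... | yes _ = refl
... | no  _ = refl

χ-suc : ∀ s (B : Subset n) p → χ (s ∷ B) (suc p) ≡ χ B p
χ-suc s B p with p ∈? B
... | yes _ = refl
... | no  _ = refl

sum-χ : (B : Subset n) → sum (χ B) ≡ ∣ B ∣
sum-χ []            = refl
sum-χ (inside ∷ B)  = cong suc (trans (sum-cong-≗ (χ-suc inside B)) (sum-χ B))
sum-χ (outside ∷ B) = trans (sum-cong-≗ (χ-suc outside B)) (sum-χ B)

-- The Gram matrix of the point-block incidences: off the diagonal it counts blocks through a pair,
-- on the diagonal blocks through a point.
cover : List (Subset n) → Fin n → Fin n → ℕ
cover []       p q = 0
cover (B ∷ Bs) p q = χ B p * χ B q + cover Bs p q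

cover≡length-filter : ∀ (Bs : List (Subset n)) p q → length (filter (pair p q ⊆?_) Bs) ≡ cover Bs p q
cover≡length-filter []       p q = refl
cover≡length-filter (B ∷ Bs) p q with pair p q ⊆? B | p ∈? B | q ∈? B
... | yes _   | yes _   | yes _   = cong suc (cover≡length-filter Bs p q)
... | yes pq⊆ | no p∉B  | _       = contradiction (pq⊆ (x∈p∪q⁺ (inj₁ (x∈⁅x⁆ p)))) p∉B
... | yes pq⊆ | yes _   | no q∉B  = contradiction (pq⊆ (x∈p∪q⁺ (inj₂ (x∈⁅x⁆ q)))) q∉B
... | no pq⊈  | yes p∈B | yes q∈B = ⊥-elim (pq⊈ (pair⊆ p∈B q∈B))
... | no _    | no _    | _       = cover≡length-filter Bs p q
... | no _    | yes _   | no _    = cover≡length-filter Bs p q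

-- A block through `p` contributes once for each of its three points, `p` included; any other block
-- contributes nothing.
sum-cover-row : {Bs : List (Subset n)} → All (λ B → ∣ B ∣ ≡ 3) Bs → ∀ p → sum (cover Bs p) ≡ 3 * cover Bs p p
sum-cover-row {n} []                             p = sum-replicate-zero n
sum-cover-row {n} {B ∷ Bs} (∣B∣≡3 ∷ sizes) p = begin
  sum (λ q → χ B p * χ B q + cover Bs p q)         ≡⟨ ∑-distrib-+ (λ q → χ B p * χ B q) (cover Bs p) ⟩
  sum (λ q → χ B p * χ B q) + sum (cover Bs p)     ≡⟨ cong₂ _+_ (sym (*-distribˡ-sum (χ B p) (χ B))) (sum-cover-row sizes p) ⟩
  χ B p * sum (χ B) + 3 * cover Bs p p             ≡⟨ cong (λ k → χ B p * k + 3 * cover Bs p p) (trans (sum-χ B) ∣B∣≡3) ⟩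
  χ B p * 3 + 3 * cover Bs p p                     ≡⟨ factor (χ B p) (cover Bs p p) ⟩
  3 * (χ B p + cover Bs p p)                       ≡⟨ cong (λ k → 3 * (k + cover Bs p p)) (χ-idem B p) ⟨
  3 * (χ B p * χ B p + cover Bs p p)               ∎
  where
  open ≡-Reasoning
  factor : ∀ x y → x * 3 + 3 * y ≡ 3 * (x + y)
  factor = solve-∀

sum-cover-diagonal : {Bs : List (Subset n)} → All (λ B → ∣ B ∣ ≡ 3) Bs → sum (λ p → cover Bs p p) ≡ length Bs * 3
sum-cover-diagonal {n} []                       = sum-replicate-zero n
sum-cover-diagonal {n} {B ∷ Bs} (∣B∣≡3 ∷ sizes) = begin
  sum (λ p → χ B p * χ B p + cover Bs p p)               ≡⟨ ∑-distrib-+ (λ p → χ B p * χ B p) (λ p → cover Bs p p) ⟩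
  sum (λ p → χ B p * χ B p) + sum (λ p → cover Bs p p)   ≡⟨ cong₂ _+_ (trans (sum-cong-≗ (χ-idem B)) (trans (sum-χ B) ∣B∣≡3)) (sum-cover-diagonal sizes) ⟩
  3 + length Bs * 3                                      ∎
  where open ≡-Reasoning

-- A point in c blocks meets the n other points 2c times in all, so c ≥ n when
-- every pair is covered twice; the number of blocks then forces equality.
cover≡2 : {Bs : List (Subset (suc n))} → All (λ B → ∣ B ∣ ≡ 3) Bs → length Bs * 3 ≡ suc n * n →
          (∀ p q → p ≢ q → 2 ≤ cover Bs p q) → ∀ p q → p ≢ q → cover Bs p q ≡ 2
cover≡2 {n} {Bs} sizes count 2≤cover p q p≢q = trans (sym (row-rigid q)) off-diagonal
  where
  open ≤-Reasoning

  below : ∀ p q → at-or-2 p (cover Bs p p) q ≤ cover Bs p q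
  below p q with p ≟ q
  ... | yes refl = ≤-refl
  ... | no p≢q  = 2≤cover p q p≢q

  arith₁ : ∀ c → 3 * c + 2 ≡ c + (2 + c * 2)
  arith₁ = solve-∀

  replication-≥ : ∀ p → n ≤ cover Bs p p
  replication-≥ p = *-cancelʳ-≤ n c 2 (+-cancelˡ-≤ (c + 2) _ _ (begin
    c + 2 + n * 2                 ≡⟨ +-assoc c 2 (n * 2) ⟩
    c + suc n * 2                 ≡⟨ sum-at-or-2 p c ⟨
    sum (at-or-2 p c) + 2         ≤⟨ +-monoˡ-≤ 2 (sum-mono-≤ (below p)) ⟩
    sum (cover Bs p) + 2          ≡⟨ cong (_+ 2) (sum-cover-row sizes p) ⟩
    3 * c + 2                     ≡⟨ arith₁ c ⟩
    c + (2 + c * 2)               ≡⟨ +-assoc c 2 (c * 2) ⟨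
    c + 2 + c * 2                 ∎))
    where c = cover Bs p p

  replication : n ≡ cover Bs p p
  replication = sum-mono-rigid replication-≥
    (≤-reflexive (trans (sum-cover-diagonal sizes) (trans count (sym (sum-const (suc n) n))))) p

  row-rigid : ∀ q → at-or-2 p (cover Bs p p) q ≡ cover Bs p q
  -- As `c` equals `n`, the row sum `3 * c` is exactly the sum `c + n * 2` of the lower bounds, so
  -- each entry attains its bound.
  row-rigid = sum-mono-rigid (below p) (+-cancelʳ-≤ 2 _ _ (begin
    sum (cover Bs p) + 2                ≡⟨ cong (_+ 2) (sum-cover-row sizes p) ⟩
    3 * c + 2                           ≡⟨ arith₁ c ⟩
    c + (2 + c * 2)                     ≡⟨ cong (λ k → c + (2 + k * 2)) replication ⟨
    c + suc n * 2                       ≡⟨ sum-at-or-2 p c ⟨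
    sum (at-or-2 p c) + 2               ∎))
    where c = cover Bs p p

  off-diagonal : at-or-2 p (cover Bs p p) q ≡ 2
  off-diagonal with p ≟ q
  ... | yes p≡q = contradiction p≡q p≢q
  ... | no _    = refl

module _ {I : Set} (block : I → Subset n) {p q : Fin n} where

  cover-≥1 : ∀ {u us} → u ∈ₗ us → p ∈ block u → q ∈ block u → 1 ≤ cover (List.map block us) p q
  cover-≥1 (here refl) pu qu rewrite χ-∈ pu | χ-∈ qu = s≤s z≤n
  cover-≥1 (there u∈)  pu qu = ≤-trans (cover-≥1 u∈ pu qu) (m≤n+m _ _)

  -- Different indices occupy different positions of the list, so both occurrences count even if the
  -- two blocks are equal as sets.
  cover-≥2 : ∀ {u v us} → u ≢ v → u ∈ₗ us → v ∈ₗ us → p ∈ block u → q ∈ block u → p ∈ block v → q ∈ block v →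
             2 ≤ cover (List.map block us) p q
  cover-≥2 u≢v (here refl) (here refl) pu qu pv qv = contradiction refl u≢v
  cover-≥2 u≢v (here refl) (there v∈)  pu qu pv qv rewrite χ-∈ pu | χ-∈ qu = s≤s (cover-≥1 v∈ pv qv)
  cover-≥2 u≢v (there u∈)  (here refl) pu qu pv qv rewrite χ-∈ pv | χ-∈ qv = s≤s (cover-≥1 u∈ pu qu)
  cover-≥2 u≢v (there u∈)  (there v∈)  pu qu pv qv = ≤-trans (cover-≥2 u≢v u∈ v∈ pu qu pv qv) (m≤n+m _ _)

balanced⁺ : {Bs : List (Subset (suc n))} → All (λ B → ∣ B ∣ ≡ 3) Bs → length Bs * 3 ≡ suc n * n →
            (∀ p q → p ≢ q → 2 ≤ cover Bs p q) → Balanced Bs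
balanced⁺ {Bs = Bs} sizes count 2≤cover P ∣P∣≡2 with pair-elements P ∣P∣≡2
... | p , q , p≢q , refl = trans (cover≡length-filter Bs p q) (cover≡2 sizes count 2≤cover p q p≢q)

-- Shifts modulo t = 2s + 1

half : ∀ d → ∃ λ a → d ≡ a + a ⊎ d ≡ suc (a + a)
half zero    = 0 , inj₁ refl
half (suc d) with half d
... | a , inj₁ d≡ = a , inj₂ (cong suc d≡)
... | a , inj₂ d≡ = suc a , inj₁ (cong suc (trans d≡ (sym (+-suc a a))))

-- If `a` exceeded `b`, then `a + a` would be at least `b + b + 2`.
double-cancel-≤ : ∀ {a b} → a + a ≤ suc (b + b) → a ≤ b
double-cancel-≤ {a} {b} 2a≤ with a ≤? b
... | yes a≤b = a≤b
... | no a≰b  = contradiction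
  (≤-trans (≤-trans (≤-reflexive (sym (cong suc (+-suc b b)))) (+-mono-≤ (≰⇒> a≰b) (≰⇒> a≰b))) 2a≤) 1+n≰n

module Shift (s : ℕ) where

  t : ℕ
  t = suc (s + s)

  private
    infix 4 _≡ₜ_

    _≡ₜ_ : ℤ → ℤ → Set
    a ≡ₜ b = ∃ λ k → a ≡ b ℤ.+ k ℤ.* + t

  -- A nonzero multiple of `t` between the two numbers would push the larger one to `t` or beyond.
  residue-unique : ∀ {m n} → m < t → n < t → + m ≡ₜ + n → m ≡ n
  residue-unique {m} {n} m<t n<t (+ zero , eq) = ℤ.+-injective (trans eq (ℤ.+-identityʳ (+ n)))
  residue-unique {m} {n} m<t n<t (k@(+ suc j) , eq) = contradiction m<t (≤⇒≯ (subst (t ≤_) (sym m≡) (≤-trans (m≤m+n t (j * t)) (m≤n+m (t + j * t) n))))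
    where
    m≡ : m ≡ n + suc j * t
    m≡ = ℤ.+-injective (trans eq (cong (λ z → + n ℤ.+ z) (sym (ℤ.pos-* (suc j) t))))
  residue-unique {m} {n} m<t n<t (k@(-[1+ j ]) , eq) = contradiction n<t (≤⇒≯ (subst (t ≤_) m≡ (≤-trans (m≤m+n t (j * t)) (m≤n+m (t + j * t) m))))
    where
    move : ∀ n k t → n ℤ.+ (- k) ℤ.* t ℤ.+ k ℤ.* t ≡ n
    move = solveℤ
    m≡ : m + suc j * t ≡ n
    m≡ = ℤ.+-injective (trans (cong (λ z → + m ℤ.+ z) (ℤ.pos-* (suc j) t)) (trans (cong (ℤ._+ (+ suc j ℤ.* + t)) eq) (move (+ n) (+ suc j) (+ t))))

  opaque
    ⟦_⟧ : ℤ → Fin t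
    ⟦ z ⟧ = fromℕ< (n%ℕd<d z t)

    ⟦⟧-residue : ∀ z → + toℕ ⟦ z ⟧ ≡ₜ z
    ⟦⟧-residue z = - (z /ℕ t) , (begin
      + toℕ ⟦ z ⟧                                                 ≡⟨ cong +_ (toℕ-fromℕ< (n%ℕd<d z t)) ⟩
      + (z %ℕ t)                                                  ≡⟨ move (+ (z %ℕ t)) (z /ℕ t) (+ t) ⟩
      + (z %ℕ t) ℤ.+ z /ℕ t ℤ.* + t ℤ.+ (- (z /ℕ t)) ℤ.* + t       ≡⟨ cong (ℤ._+ (- (z /ℕ t)) ℤ.* + t) (a≡a%ℕn+[a/ℕn]*n z t) ⟨
      z ℤ.+ (- (z /ℕ t)) ℤ.* + t                                  ∎)
      where
      open ≡-Reasoning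
      move : ∀ r q t → r ≡ r ℤ.+ q ℤ.* t ℤ.+ (- q) ℤ.* t
      move = solveℤ

  ⟦⟧-cong : ∀ {a b} → a ≡ₜ b → ⟦ a ⟧ ≡ ⟦ b ⟧
  ⟦⟧-cong {a} {b} (k , a≡) with ⟦⟧-residue a | ⟦⟧-residue b
  ... | i , ra | j , rb = toℕ-injective (residue-unique (toℕ<n ⟦ a ⟧) (toℕ<n ⟦ b ⟧) (i ℤ.+ k ℤ.- j , (begin
    + toℕ ⟦ a ⟧                                                    ≡⟨ ra ⟩
    a ℤ.+ i ℤ.* + t                                                ≡⟨ cong (ℤ._+ i ℤ.* + t) a≡ ⟩
    b ℤ.+ k ℤ.* + t ℤ.+ i ℤ.* + t                                  ≡⟨ move b i j k (+ t) ⟩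
    b ℤ.+ j ℤ.* + t ℤ.+ (i ℤ.+ k ℤ.- j) ℤ.* + t                    ≡⟨ cong (ℤ._+ (i ℤ.+ k ℤ.- j) ℤ.* + t) rb ⟨
    + toℕ ⟦ b ⟧ ℤ.+ (i ℤ.+ k ℤ.- j) ℤ.* + t                        ∎)))
    where
    open ≡-Reasoning
    move : ∀ b i j k t → b ℤ.+ k ℤ.* t ℤ.+ i ℤ.* t ≡ b ℤ.+ j ℤ.* t ℤ.+ (i ℤ.+ k ℤ.- j) ℤ.* t
    move = solveℤ

  ⟦toℕ⟧ : ∀ r → ⟦ + toℕ r ⟧ ≡ r
  ⟦toℕ⟧ r = toℕ-injective (residue-unique (toℕ<n ⟦ + toℕ r ⟧) (toℕ<n r) (⟦⟧-residue (+ toℕ r)))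

  infixl 6 _⊕_

  opaque
    -- The offset stays an integer, so that successive translations merge into one and offsets are
    -- compared by integer arithmetic.
    _⊕_ : Fin t → ℤ → Fin t
    r ⊕ z = ⟦ + toℕ r ℤ.+ z ⟧

    ⊕-assoc : ∀ r a b → r ⊕ a ⊕ b ≡ r ⊕ (a ℤ.+ b)
    ⊕-assoc r a b with ⟦⟧-residue (+ toℕ r ℤ.+ a)
    ... | k , eq = ⟦⟧-cong (k , trans (cong (ℤ._+ b) eq) (move (+ toℕ r) a b (k ℤ.* + t)))
      where
      move : ∀ r a b k → r ℤ.+ a ℤ.+ k ℤ.+ b ≡ r ℤ.+ (a ℤ.+ b) ℤ.+ k
      move = solveℤ

    ⊕-identity : ∀ r → r ⊕ 0ℤ ≡ r
    ⊕-identity r = trans (cong ⟦_⟧ (ℤ.+-identityʳ (+ toℕ r))) (⟦toℕ⟧ r)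

    ⊕-period : ∀ r k → r ⊕ k ℤ.* + t ≡ r
    ⊕-period r k = trans (⟦⟧-cong (k , refl)) (⟦toℕ⟧ r)

    ⊕-fixed-free : ∀ {r d} → 0 < d → d < t → r ⊕ + d ≢ r
    ⊕-fixed-free {r} {d} 0<d d<t eq with ⟦⟧-residue (+ toℕ r ℤ.+ + d)
    ... | k , eq′ = contradiction (residue-unique d<t (s≤s z≤n) (- k , (begin
      + d                                                              ≡⟨ move (+ toℕ r) (+ d) (k ℤ.* + t) ⟩
      0ℤ ℤ.+ (+ toℕ r ℤ.+ + d ℤ.+ k ℤ.* + t) ℤ.- + toℕ r ℤ.- k ℤ.* + t  ≡⟨ cong (λ z → 0ℤ ℤ.+ z ℤ.- + toℕ r ℤ.- k ℤ.* + t) eq′ ⟨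
      0ℤ ℤ.+ + toℕ (r ⊕ + d) ℤ.- + toℕ r ℤ.- k ℤ.* + t                  ≡⟨ cong (λ z → 0ℤ ℤ.+ + toℕ z ℤ.- + toℕ r ℤ.- k ℤ.* + t) eq ⟩
      0ℤ ℤ.+ + toℕ r ℤ.- + toℕ r ℤ.- k ℤ.* + t                          ≡⟨ move′ (+ toℕ r) k (+ t) ⟩
      0ℤ ℤ.+ (- k) ℤ.* + t                                              ∎))) (>⇒≢ 0<d)
      where
      open ≡-Reasoning
      move : ∀ r d k → d ≡ 0ℤ ℤ.+ (r ℤ.+ d ℤ.+ k) ℤ.- r ℤ.- k
      move = solveℤ
      move′ : ∀ r k t → 0ℤ ℤ.+ r ℤ.- r ℤ.- k ℤ.* t ≡ 0ℤ ℤ.+ (- k) ℤ.* t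
      move′ = solveℤ

    difference : ∀ x y → ∃ λ d → d < t × y ≡ x ⊕ + d
    difference x y with ⟦⟧-residue (+ toℕ y ℤ.- + toℕ x)
    ... | k , eq = toℕ ⟦ + toℕ y ℤ.- + toℕ x ⟧ , toℕ<n ⟦ + toℕ y ℤ.- + toℕ x ⟧ ,
      sym (trans (⟦⟧-cong (k , trans (cong (λ z → + toℕ x ℤ.+ z) eq) (move (+ toℕ x) (+ toℕ y) (k ℤ.* + t)))) (⟦toℕ⟧ y))
      where
      move : ∀ x y k → x ℤ.+ (y ℤ.- x ℤ.+ k) ≡ y ℤ.+ k
      move = solveℤ

  ⊕-inverse : ∀ r a → r ⊕ a ⊕ - a ≡ r
  ⊕-inverse r a = trans (⊕-assoc r a (- a)) (trans (cong (r ⊕_) (ℤ.+-inverseʳ a)) (⊕-identity r))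

  ⊕-move : ∀ {x y a} → x ≡ y ⊕ a → y ≡ x ⊕ - a
  ⊕-move {y = y} {a} refl = sym (⊕-inverse y a)

  -- Going on by `e` completes one full turn.
  complement : ∀ {x y d e} → y ≡ x ⊕ + d → d + e ≡ t → x ≡ y ⊕ + e
  complement {x} {y} {d} {e} refl d+e≡t = sym (trans (⊕-assoc x (+ d) (+ e))
    (trans (cong (λ k → x ⊕ + k) d+e≡t) (trans (cong (x ⊕_) (sym (ℤ.*-identityˡ (+ t)))) (⊕-period x 1ℤ))))

  -- Since `t` is odd, one of the two directed differences `d` and `t - d` is even; half of it leads
  -- to a midpoint of the pair.
  even-difference : ∀ x y → x ≢ y → ∃ λ a → 0 < a × a ≤ s × (y ≡ x ⊕ + (a + a) ⊎ x ≡ y ⊕ + (a + a))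
  even-difference x y x≢y with difference x y
  ... | d , d<t , y≡ with half d
  ...   | zero , inj₁ refl = contradiction (sym (trans y≡ (⊕-identity x))) x≢y
  ...   | a@(suc _) , inj₁ refl = a , s≤s z≤n , double-cancel-≤ (<⇒≤ d<t) , inj₁ y≡
  -- For `d = 2a + 1` the opposite difference is `t - d = 2(s - a)`.
  ...   | a , inj₂ refl = s ∸ a , m<n⇒0<n∸m a<s , m∸n≤m s a ,
      inj₂ (complement y≡ (trans (cong suc (swap a (s ∸ a))) (cong (λ k → suc (k + k)) (m+[n∸m]≡n (<⇒≤ a<s)))))
    where
    swap : ∀ a b → a + a + (b + b) ≡ (a + b) + (a + b)
    swap = solve-∀
    a<s : a < s
    a<s = double-cancel-≤ (≤-trans (≤-reflexive (cong suc (+-suc a a))) d<t)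

  centred-difference : ∀ x y → ∃ λ a → a ≤ s × (y ≡ x ⊕ + a ⊎ y ≡ x ⊕ - + a)
  centred-difference x y with difference x y
  ... | d , d<t , y≡ with d ≤? s
  ...   | yes d≤s = d , d≤s , inj₁ y≡
  ...   | no d≰s  = t ∸ d , m≤n+o⇒m∸n≤o t d (+-monoˡ-≤ s (≰⇒> d≰s)) ,
      inj₂ (⊕-move (complement y≡ (m+[n∸m]≡n (<⇒≤ d<t))))

  -- 2 is a unit modulo `t`: an odd representative becomes even on adding `t`. The bound keeps the
  -- half among the numbers 0 to `t - 1` of the laps.
  halving : ∀ x → ∃ λ a → a ≤ s + s × x ≡ zero ⊕ + (a + a)
  halving x with difference zero x
  ... | d , d<t , x≡ with half d
  ...   | a , inj₁ refl = a , ≤-trans (m≤m+n a a) (s≤s⁻¹ d<t) , x≡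
  ...   | a , inj₂ refl = a + suc s , ≤-trans (≤-reflexive (+-suc a s)) (+-monoˡ-≤ s a<s) , (begin
      x                                            ≡⟨ ⊕-period x 1ℤ ⟨
      x ⊕ 1ℤ ℤ.* + t                                ≡⟨ cong (x ⊕_) (ℤ.*-identityˡ (+ t)) ⟩
      x ⊕ + t                                       ≡⟨ cong (_⊕ + t) x≡ ⟩
      zero ⊕ + suc (a + a) ⊕ + t                    ≡⟨ ⊕-assoc zero (+ suc (a + a)) (+ t) ⟩
      zero ⊕ + (suc (a + a) + t)                    ≡⟨ cong (λ k → zero ⊕ + k) (swap a s) ⟩
      zero ⊕ + (a + suc s + (a + suc s))            ∎)
    where
    open ≡-Reasoning
    swap : ∀ a s → suc (a + a) + suc (s + s) ≡ a + suc s + (a + suc s)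
    swap = solve-∀
    a<s : a < s
    a<s = double-cancel-≤ (≤-trans (≤-reflexive (cong suc (+-suc a a))) d<t)

-- The system of order 3t + 1

infix 8 _·_

_·_ : Sign → ℕ → ℤ
Sign.+ · a = + a
Sign.- · a = - + a

next previous : Fin 3 → Fin 3
next 0F = 1F
next 1F = 2F
next 2F = 0F
previous 0F = 2F
previous 1F = 0F
previous 2F = 1F

next-previous : ∀ i → next (previous i) ≡ i
next-previous 0F = refl
next-previous 1F = refl
next-previous 2F = refl

next≢ : ∀ i → next i ≢ i
next≢ 0F ()
next≢ 1F ()
next≢ 2F ()

previous≢ : ∀ i → previous i ≢ i
previous≢ 0F ()
previous≢ 1F ()
previous≢ 2F ()

level-trichotomy : ∀ i j → i ≡ j ⊎ j ≡ next i ⊎ i ≡ next j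
level-trichotomy 0F 0F = inj₁ refl
level-trichotomy 0F 1F = inj₂ (inj₁ refl)
level-trichotomy 0F 2F = inj₂ (inj₂ refl)
level-trichotomy 1F 0F = inj₂ (inj₂ refl)
level-trichotomy 1F 1F = inj₁ refl
level-trichotomy 1F 2F = inj₂ (inj₁ refl)
level-trichotomy 2F 0F = inj₂ (inj₁ refl)
level-trichotomy 2F 1F = inj₂ (inj₂ refl)
level-trichotomy 2F 2F = inj₁ refl

-- The signs are chosen so that one pass of the tour advances by 2, a unit
-- modulo t; with three equal signs it would close up prematurely.
δ : Fin 3 → Sign
δ 0F = Sign.-
δ 1F = Sign.+
δ 2F = Sign.+

module System (s′ : ℕ) where

  s = suc s′

  open Shift s

  ⊕-cancel : ∀ ε r a → r ⊕ ε · a ⊕ opposite ε · a ≡ r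
  ⊕-cancel Sign.+ r a = ⊕-inverse r (+ a)
  ⊕-cancel Sign.- r a = trans (cong (r ⊕ - + a ⊕_) (sym (ℤ.neg-involutive (+ a)))) (⊕-inverse r (- + a))

  ⊕-cancel′ : ∀ ε r a → r ⊕ opposite ε · a ⊕ ε · a ≡ r
  ⊕-cancel′ Sign.+ = ⊕-cancel Sign.-
  ⊕-cancel′ Sign.- = ⊕-cancel Sign.+

  ⊕-0 : ∀ ε r → r ⊕ ε · 0 ≡ r
  ⊕-0 Sign.+ = ⊕-identity
  ⊕-0 Sign.- = ⊕-identity

  ⊕-apart : ∀ r {a b d} → 0 < d → d < t → a ≡ b ℤ.+ + d → r ⊕ a ≢ r ⊕ b
  ⊕-apart r {b = b} {d} 0<d d<t refl eq = ⊕-fixed-free 0<d d<t (trans (⊕-assoc r b (+ d)) eq)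

  1<t : 1 < t
  1<t = s≤s (s≤s z≤n)

  step-apart : ∀ ε r a → r ⊕ ε · a ≢ r ⊕ ε · suc a
  step-apart Sign.+ r a = ⊕-apart r (s≤s z≤n) 1<t (eq (+ a)) ∘ sym
    where
    eq : ∀ a → 1ℤ ℤ.+ a ≡ a ℤ.+ 1ℤ
    eq = solveℤ
  step-apart Sign.- r a = ⊕-apart r (s≤s z≤n) 1<t (eq (+ a))
    where
    eq : ∀ a → - a ≡ - (1ℤ ℤ.+ a) ℤ.+ 1ℤ
    eq = solveℤ

  opposite-apart : ∀ ε r a b → 0 < a + b → a + b < t → r ⊕ ε · a ≢ r ⊕ opposite ε · b
  opposite-apart Sign.+ r a b 0< <t = ⊕-apart r 0< <t (eq (+ a) (+ b))
    where
    eq : ∀ a b → a ≡ - b ℤ.+ (a ℤ.+ b)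
    eq = solveℤ
  opposite-apart Sign.- r a b 0< <t = ⊕-apart r 0< <t (eq (+ a) (+ b)) ∘ sym
    where
    eq : ∀ a b → b ≡ - a ℤ.+ (a ℤ.+ b)
    eq = solveℤ

  -- Points and blocks.

  Point : Set
  Point = Fin (suc (3 * t))

  opaque
    ∞ : Point
    ∞ = zero

    pt : Fin 3 → Fin t → Point
    pt i x = suc (combine i x)

    pt-injective : ∀ {i j x y} → pt i x ≡ pt j y → i ≡ j × x ≡ y
    pt-injective = combine-injective _ _ _ _ ∘ Fin.suc-injective

    ∞≢pt : ∀ {i x} → ∞ ≢ pt i x
    ∞≢pt ()

    pt-surjective : ∀ p → p ≡ ∞ ⊎ ∃ λ i → ∃ λ x → p ≡ pt i x
    pt-surjective zero    = inj₁ refl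
    pt-surjective (suc p) with combine-surjective p
    ... | i , x , eq = inj₂ (i , x , cong suc (sym eq))

  levels≢ : ∀ {i j x y} → i ≢ j → pt i x ≢ pt j y
  levels≢ i≢j = i≢j ∘ proj₁ ∘ pt-injective

  points≢ : ∀ {i j x y} → x ≢ y → pt i x ≢ pt j y
  points≢ x≢y = x≢y ∘ proj₂ ∘ pt-injective

  -- O is the triangle over r; D and U are the two kinds of triangles in the fan
  -- of a zigzag path around the apex r on the next level; E is the last triangle
  -- of that fan, turned upside down; N contains ∞.
  data Index : Set where
    O   : (r : Fin t) → Index
    D U : (i : Fin 3) (a : ℕ) (r : Fin t) → Index
    E N : (i : Fin 3) (r : Fin t) → Index

  -- In units of `δ i`, the zigzag path around `r` has offsets 0, -1, 1, -2, 2, and so on: `D`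
  -- carries the edge from `a` to `-(a + 1)`, and `U` the edge from there to `a + 1`. `E` replaces
  -- the `U` with `suc a = s`: level `i` loses a pair of difference `2s`, that is -1, and the next
  -- level gains one of difference 1.
  block : Index → Subset (suc (3 * t))
  block (O r)     = triple (pt 0F r) (pt 1F r) (pt 2F r)
  block (D i a r) = triple (pt i (r ⊕ δ i · a)) (pt i (r ⊕ opposite (δ i) · suc a)) (pt (next i) r)
  block (U i a r) = triple (pt i (r ⊕ opposite (δ i) · suc a)) (pt i (r ⊕ δ i · suc a)) (pt (next i) r)
  block (E i r)   = triple (pt i (r ⊕ opposite (δ i) · s)) (pt (next i) r) (pt (next i) (r ⊕ δ i · 1))
  block (N i r)   = triple ∞ (pt i (r ⊕ opposite (δ i) · s)) (pt (next i) (r ⊕ δ i · 1))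

  up : ∀ i {x y} → pt i x ≢ pt (next i) y
  up i = levels≢ (next≢ i ∘ sym)

  D-apart : ∀ i r {a} → a < s → r ⊕ δ i · a ≢ r ⊕ opposite (δ i) · suc a
  D-apart i r {a} a<s = opposite-apart (δ i) r a (suc a) (≤-trans (s≤s z≤n) (m≤n+m (suc a) a)) (s≤s (+-mono-≤ (<⇒≤ a<s) a<s))

  U-apart : ∀ i r {a} → suc a < s → r ⊕ δ i · suc a ≢ r ⊕ opposite (δ i) · suc a
  U-apart i r {a} a<s = opposite-apart (δ i) r (suc a) (suc a) (s≤s z≤n) (s≤s (+-mono-≤ (<⇒≤ a<s) (<⇒≤ a<s)))

  1-apart : ∀ i r → r ≢ r ⊕ δ i · 1
  1-apart i r eq = step-apart (δ i) r 0 (trans (⊕-0 (δ i) r) eq)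

  size-O : ∀ r → ∣ block (O r) ∣ ≡ 3
  size-O r = ∣triple∣ (levels≢ λ ()) (levels≢ λ ()) (levels≢ λ ())

  size-D : ∀ i r {a} → a < s → ∣ block (D i a r) ∣ ≡ 3
  size-D i r a<s = ∣triple∣ (points≢ (D-apart i r a<s)) (up i) (up i)

  size-U : ∀ i r {a} → suc a < s → ∣ block (U i a r) ∣ ≡ 3
  size-U i r a<s = ∣triple∣ (points≢ (U-apart i r a<s ∘ sym)) (up i) (up i)

  size-E : ∀ i r → ∣ block (E i r) ∣ ≡ 3
  size-E i r = ∣triple∣ (up i) (up i) (points≢ (1-apart i r))

  size-N : ∀ i r → ∣ block (N i r) ∣ ≡ 3
  size-N i r = ∣triple∣ ∞≢pt ∞≢pt (up i)

  -- Adjacencies between blocks.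

  Adjacent : Index → Index → Set
  Adjacent u v = Linked (block u) (block v)

  D-U : ∀ i r {a} → suc a < s → Adjacent (D i a r) (U i a r)
  D-U i r {a} a<s = linked⁺ _ _ _ (size-D i r (<⇒≤ a<s)) (size-U i r a<s) (up i) 2nd 1st 3rd 3rd 1st
    (∉triple (points≢ (D-apart i r (<⇒≤ a<s))) (points≢ (step-apart (δ i) r a)) (up i))

  U-D : ∀ i r {a} → suc a < s → Adjacent (U i a r) (D i (suc a) r)
  U-D i r {a} a<s = linked⁺ _ _ _ (size-U i r a<s) (size-D i r a<s) (up i) 2nd 1st 3rd 3rd 1st
    (∉triple (points≢ (U-apart i r a<s ∘ sym)) (points≢ (step-apart (opposite (δ i)) r (suc a))) (up i))

  D-E : ∀ i r → Adjacent (D i s′ r) (E i r)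
  D-E i r = linked⁺ _ _ _ (size-D i r ≤-refl) (size-E i r) (up i) 2nd 1st 3rd 2nd 1st
    (∉triple (points≢ (D-apart i r ≤-refl)) (up i) (up i))

  E-N : ∀ i r → Adjacent (E i r) (N i r)
  E-N i r = linked⁺ _ _ _ (size-E i r) (size-N i r) (up i) 1st 2nd 3rd 3rd 2nd
    (∉triple (∞≢pt ∘ sym) (up i ∘ sym) (points≢ (1-apart i r)))

  ∈O : ∀ i r → pt i r ∈ block (O r)
  ∈O 0F r = 1st
  ∈O 1F r = 2nd
  ∈O 2F r = 3rd

  centre∈D₀ : ∀ i r → pt i r ∈ block (D i 0 r)
  centre∈D₀ i r = subst (λ x → pt i x ∈ block (D i 0 r)) (⊕-0 (δ i) r) 1st

  previous≢next : ∀ i → previous i ≢ next i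
  previous≢next 0F ()
  previous≢next 1F ()
  previous≢next 2F ()

  -- The fan starts at offset 0, so its first triangle contains both `r` on level `i` and the apex
  -- `r` above it.
  O-D : ∀ i r → Adjacent (O r) (D i 0 r)
  O-D i r = linked⁺ (pt i r) (pt (next i) r) (pt (previous i) r) (size-O r) (size-D i r (s≤s z≤n)) (up i)
    (∈O i r) (centre∈D₀ i r) (∈O (next i) r) 3rd (∈O (previous i) r)
    (∉triple (levels≢ (previous≢ i)) (levels≢ (previous≢ i)) (levels≢ (previous≢next i)))

  -- Besides `∞` they share `r + 1` on level 2, because `(r + s + 1) - s = r + 1`.
  N₁-N₂ : ∀ r → Adjacent (N 1F r) (N 2F (r ⊕ + suc s))
  N₁-N₂ r = linked⁺ ∞ (pt 2F (r ⊕ + 1)) _ (size-N 1F r) (size-N 2F _) ∞≢pt 1st 1st 3rd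
    (subst (λ x → pt 2F x ∈ block (N 2F (r ⊕ + suc s))) shift 2nd)
    2nd (∉triple (∞≢pt ∘ sym) (levels≢ λ ()) (levels≢ λ ()))
    where
    eq : ∀ s → 1ℤ ℤ.+ s ℤ.+ - s ≡ 1ℤ
    eq = solveℤ
    shift : r ⊕ + suc s ⊕ - + s ≡ r ⊕ + 1
    shift = trans (⊕-assoc r (+ suc s) (- + s)) (cong (r ⊕_) (eq (+ s)))

  N₂-N₀ : ∀ r → Adjacent (N 2F (r ⊕ + suc s)) (N 0F (r ⊕ + 2))
  N₂-N₀ r = linked⁺ ∞ _ _ (size-N 2F _) (size-N 0F _) ∞≢pt 1st 1st 3rd
    (subst (λ x → pt 0F x ∈ block (N 0F (r ⊕ + 2))) shift 2nd)
    2nd (∉triple (∞≢pt ∘ sym) (levels≢ λ ()) (levels≢ λ ()))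
    where
    eq : ∀ s → + 2 ℤ.+ s ≡ 1ℤ ℤ.+ s ℤ.+ 1ℤ
    eq = solveℤ
    shift : r ⊕ + 2 ⊕ + s ≡ r ⊕ + suc s ⊕ + 1
    shift = trans (⊕-assoc r (+ 2) (+ s)) (trans (cong (r ⊕_) (eq (+ s))) (sym (⊕-assoc r (+ suc s) (+ 1))))

  -- This adjacency comes from the flip: the flipped triangle over level 2 has the edge from `r` to
  -- `r + 1` on level 0, where the path of `D` begins, since `δ 0F` and `δ 2F` are opposite.
  D₀-E₂ : ∀ r → Adjacent (D 0F 0 r) (E 2F r)
  D₀-E₂ r = linked⁺ (pt 0F r) (pt 0F (r ⊕ + 1)) (pt 1F r) (size-D 0F r (s≤s z≤n)) (size-E 2F r)
    -- As `δ 1F` is positive, `1-apart 1F` separates `r` from `r + 1`.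
    (points≢ (1-apart 1F r)) (centre∈D₀ 0F r) 2nd 2nd 3rd 3rd
    (∉triple (levels≢ λ ()) (levels≢ λ ()) (levels≢ λ ()))

  -- The tour and its length.

  zigzag : Fin 3 → Fin t → ℕ → ℕ → List Index
  zigzag i r a zero    = E i r ∷ []
  zigzag i r a (suc k) = U i a r ∷ D i (suc a) r ∷ zigzag i r (suc a) k

  fan : Fin 3 → Fin t → List Index
  fan i r = D i 0 r ∷ zigzag i r 0 s′

  -- The fan over level 1 is run forwards at `r`, those over levels 0 and 2 backwards at `r + 2`.
  -- The lap thus ends at `D 2F 0 (r ⊕ + 2)`, which is linked to the `O` opening the next lap.
  lap : Fin t → List Index
  lap r = O r ∷ fan 1F r ++ (N 1F r ∷ N 2F (r ⊕ + suc s) ∷ N 0F (r ⊕ + 2) ∷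
            (reverse (fan 0F (r ⊕ + 2)) ++ reverse (fan 2F (r ⊕ + 2))))

  tour : ℕ → Fin t → List Index
  tour zero    r = lap r
  tour (suc m) r = lap r ++ tour m (r ⊕ + 2)

  zigzag-path : ∀ i r a k → a + k ≡ s′ → Path Adjacent (D i a r) (E i r) (D i a r ∷ zigzag i r a k)
  zigzag-path i r a zero    eq rewrite trans (sym (+-identityʳ a)) eq = D-E i r ∷ [ E i r ]
  zigzag-path i r a (suc k) eq = D-U i r a<s ∷ U-D i r a<s ∷ zigzag-path i r (suc a) k (trans (sym (+-suc a k)) eq)
    where
    a<s : suc a < s
    a<s = s≤s (subst (suc a ≤_) (trans (sym (+-suc a k)) eq) (m≤m+n (suc a) k))

  fan-path : ∀ i r → Path Adjacent (D i 0 r) (E i r) (fan i r)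
  fan-path i r = zigzag-path i r 0 s′ refl

  lap-path : ∀ r → Path Adjacent (O r) (D 2F 0 (r ⊕ + 2)) (lap r)
  lap-path r = O-D 1F r ∷ path-++ (fan-path 1F r) (E-N 1F r)
    (N₁-N₂ r ∷ N₂-N₀ r ∷ linked-sym (E-N 0F q) ∷
      path-++ (path-reverse linked-sym (fan-path 0F q)) (D₀-E₂ q) (path-reverse linked-sym (fan-path 2F q)))
    where q = r ⊕ + 2

  tour-path : ∀ m r → Path Adjacent (O r) (D 2F 0 (r ⊕ + (suc m + suc m))) (tour m r)
  tour-path zero    r = lap-path r
  tour-path (suc m) r = path-++ (lap-path r) (linked-sym (O-D 2F q))
    (subst (λ x → Path Adjacent (O q) (D 2F 0 x) (tour m q)) shift (tour-path m q))
    where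
    q = r ⊕ + 2
    shift : q ⊕ + (suc m + suc m) ≡ r ⊕ + (suc (suc m) + suc (suc m))
    shift = trans (⊕-assoc r (+ 2) (+ (suc m + suc m))) (cong (λ k → r ⊕ + suc (suc k)) (sym (+-suc m (suc m))))

  length-zigzag : ∀ i r a k → length (zigzag i r a k) ≡ suc (k + k)
  length-zigzag i r a zero    = refl
  length-zigzag i r a (suc k) = cong (λ l → suc (suc l)) (trans (length-zigzag i r (suc a) k) (sym (+-suc k k)))

  -- One `O`, three `N` and three fans of `2s` blocks make `6s + 4`.
  length-lap : ∀ r → length (lap r) ≡ suc (3 * t)
  length-lap r = begin
    length (lap r)                                                                ≡⟨ cong suc (length-++ (fan 1F r)) ⟩
    suc (length (fan 1F r) + (3 + length (reverse (fan 0F q) ++ reverse (fan 2F q))))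
      ≡⟨ cong (λ k → suc (length (fan 1F r) + (3 + k))) (trans (length-++ (reverse (fan 0F q))) (cong₂ _+_ (length-reverse (fan 0F q)) (length-reverse (fan 2F q)))) ⟩
    suc (length (fan 1F r) + (3 + (length (fan 0F q) + length (fan 2F q))))
      ≡⟨ cong₂ (λ j k → suc (j + (3 + k))) (length-fan 1F r) (cong₂ _+_ (length-fan 0F q) (length-fan 2F q)) ⟩
    suc (s + s + (3 + (s + s + (s + s))))                                         ≡⟨ cong suc (arith (s + s)) ⟩
    suc (3 * t)                                                                   ∎
    where
    open ≡-Reasoning
    q = r ⊕ + 2
    length-fan : ∀ i r → length (fan i r) ≡ s + s
    length-fan i r = cong suc (trans (length-zigzag i r 0 s′) (sym (+-suc s′ s′)))
    arith : ∀ x → x + (3 + (x + x)) ≡ 3 * (1 + x)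
    arith = solve-∀

  length-tour : ∀ m r → length (tour m r) ≡ suc m * suc (3 * t)
  length-tour zero    r = trans (length-lap r) (sym (+-identityʳ _))
  length-tour (suc m) r = trans (length-++ (lap r)) (cong₂ _+_ (length-lap r) (length-tour m (r ⊕ + 2)))

  -- Every block occurs in the tour.

  U∈zigzag : ∀ i r {a b k} → a ≤ b → b < a + k → U i b r ∈ₗ zigzag i r a k
  U∈zigzag i r {a} {b} {zero}  a≤b b< = contradiction (≤-trans b< (≤-trans (≤-reflexive (+-identityʳ a)) a≤b)) 1+n≰n
  U∈zigzag i r {a} {b} {suc k} a≤b b< with m≤n⇒m<n∨m≡n a≤b
  ... | inj₁ a<b  = there (there (U∈zigzag i r a<b (≤-trans b< (≤-reflexive (+-suc a k)))))
  ... | inj₂ refl = here refl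

  D∈zigzag : ∀ i r {a b k} → a < b → b ≤ a + k → D i b r ∈ₗ zigzag i r a k
  D∈zigzag i r {a} {b} {zero}  a<b b≤ = contradiction (≤-trans a<b (≤-trans b≤ (≤-reflexive (+-identityʳ a)))) 1+n≰n
  D∈zigzag i r {a} {b} {suc k} a<b b≤ with m≤n⇒m<n∨m≡n a<b
  ... | inj₁ a<b  = there (there (D∈zigzag i r a<b (≤-trans b≤ (≤-reflexive (+-suc a k)))))
  ... | inj₂ refl = there (here refl)

  E∈zigzag : ∀ i r a k → E i r ∈ₗ zigzag i r a k
  E∈zigzag i r a zero    = here refl
  E∈zigzag i r a (suc k) = there (there (E∈zigzag i r (suc a) k))

  Tour : List Index
  Tour = tour (s + s) zero

  lap⊆tour : ∀ {u} m r a → a ≤ m → u ∈ₗ lap (r ⊕ + (a + a)) → u ∈ₗ tour m r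
  lap⊆tour {u} zero    r zero    a≤m       u∈ = subst (λ x → u ∈ₗ lap x) (⊕-identity r) u∈
  lap⊆tour {u} (suc m) r zero    a≤m       u∈ = ∈-++⁺ˡ (subst (λ x → u ∈ₗ lap x) (⊕-identity r) u∈)
  lap⊆tour {u} (suc m) r (suc a) (s≤s a≤m) u∈ = ∈-++⁺ʳ (lap r) (lap⊆tour m (r ⊕ + 2) a a≤m (subst (λ x → u ∈ₗ lap x) shift u∈))
    where
    shift : r ⊕ + (suc a + suc a) ≡ r ⊕ + 2 ⊕ + (a + a)
    shift = trans (cong (λ k → r ⊕ + suc k) (+-suc a a)) (sym (⊕-assoc r (+ 2) (+ (a + a))))

  -- Lap number `a` starts at `2a`, and by `halving` these starting points exhaust the residues.
  lap⊆Tour : ∀ {u} r → u ∈ₗ lap r → u ∈ₗ Tour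
  lap⊆Tour {u} r u∈ with halving r
  ... | a , a≤ , r≡ = lap⊆tour (s + s) zero a a≤ (subst (λ x → u ∈ₗ lap x) r≡ u∈)

  -- The lap that contains `f r` is the one starting at `r - z`.
  shifted : ∀ (f : Fin t → Index) z → (∀ r → f (r ⊕ z) ∈ₗ lap r) → ∀ r → f r ∈ₗ Tour
  shifted f z f∈ r = subst (λ x → f x ∈ₗ Tour) r≡ (lap⊆Tour (r ⊕ - z) (f∈ (r ⊕ - z)))
    where
    r≡ : r ⊕ - z ⊕ z ≡ r
    r≡ = trans (⊕-assoc r (- z) z) (trans (cong (r ⊕_) (ℤ.+-inverseˡ z)) (⊕-identity r))

  fan∈Tour : ∀ (f : Fin t → Index) i → (∀ r → f r ∈ₗ fan i r) → ∀ r → f r ∈ₗ Tour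
  fan∈Tour f 0F f∈ = shifted f (+ 2) λ r → there (∈-++⁺ʳ (fan 1F r) (there (there (there
    (∈-++⁺ˡ (reverse⁺ (f∈ (r ⊕ + 2))))))))
  fan∈Tour f 1F f∈ r = lap⊆Tour r (there (∈-++⁺ˡ (f∈ r)))
  fan∈Tour f 2F f∈ = shifted f (+ 2) λ r → there (∈-++⁺ʳ (fan 1F r) (there (there (there
    (∈-++⁺ʳ (reverse (fan 0F (r ⊕ + 2))) (reverse⁺ (f∈ (r ⊕ + 2))))))))

  O∈ : ∀ r → O r ∈ₗ Tour
  O∈ r = lap⊆Tour r (here refl)

  D∈ : ∀ i {a} → a < s → ∀ r → D i a r ∈ₗ Tour
  D∈ i {zero}  a<s = fan∈Tour (D i 0) i λ r → here refl
  D∈ i {suc a} a<s = fan∈Tour (D i (suc a)) i λ r → there (D∈zigzag i r (s≤s z≤n) (s≤s⁻¹ a<s))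

  U∈ : ∀ i {a} → suc a < s → ∀ r → U i a r ∈ₗ Tour
  U∈ i {a} a<s = fan∈Tour (U i a) i λ r → there (U∈zigzag i r z≤n (s≤s⁻¹ a<s))

  E∈ : ∀ i r → E i r ∈ₗ Tour
  E∈ i = fan∈Tour (E i) i λ r → there (E∈zigzag i r 0 s′)

  N∈ : ∀ i r → N i r ∈ₗ Tour
  N∈ 0F = shifted (N 0F) (+ 2) λ r → there (∈-++⁺ʳ (fan 1F r) (there (there (here refl))))
  N∈ 1F r = lap⊆Tour r (there (∈-++⁺ʳ (fan 1F r) (here refl)))
  N∈ 2F = shifted (N 2F) (+ suc s) λ r → there (∈-++⁺ʳ (fan 1F r) (there (here refl)))

  -- Every pair lies in two blocks of different index.

  record Twice (p q : Point) : Set where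
    constructor twice
    field
      {u v} : Index
      u≢v   : u ≢ v
      u∈    : u ∈ₗ Tour
      v∈    : v ∈ₗ Tour
      p∈u   : p ∈ block u
      q∈u   : q ∈ block u
      p∈v   : p ∈ block v
      q∈v   : q ∈ block v

  twice-sym : ∀ {p q} → Twice p q → Twice q p
  twice-sym (twice u≢v u∈ v∈ pu qu pv qv) = twice u≢v u∈ v∈ qu pu qv pv

  ∈-cong : ∀ {i x y B} → x ≡ y → pt i x ∈ B → pt i y ∈ B
  ∈-cong refl p = p

  -- The point is the lower one in an `N` of its own level and the upper one in an `N` of the
  -- previous level.
  twice-∞ : ∀ i x → Twice ∞ (pt i x)
  twice-∞ i x = twice (previous≢ i ∘ sym ∘ level) (N∈ i (x ⊕ δ i · s)) (N∈ (previous i) r)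
    1st (∈-cong (⊕-cancel (δ i) x s) 2nd)
    1st (subst (λ j → pt j x ∈ block (N (previous i) r)) (next-previous i) (∈-cong (⊕-cancel′ (δ (previous i)) x 1) 3rd))
    where
    r = x ⊕ opposite (δ (previous i)) · 1
    level : ∀ {i j r r′} → N i r ≡ N j r′ → i ≡ j
    level refl = refl

  -- The even difference is realised by the `U` centred at the midpoint, or by an `E` if that
  -- triangle was flipped; the complementary odd difference is realised by a `D`.
  twice-pure : ∀ i x y a → 0 < a → a ≤ s → y ≡ x ⊕ + (a + a) → Twice (pt i x) (pt i y)
  twice-pure i x y (suc a) 0<a a<s y≡ = odd (δ i) refl
    where
    -- Chosen so that `2b + 1`, the difference of the path edge in `D i b`, is `t - 2(a + 1)`.
    b = s′ ∸ a

    b<s : b < s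
    b<s = s≤s (m∸n≤m s′ a)

    x≡ : x ≡ y ⊕ + (suc b + b)
    x≡ = complement y≡ (trans (arith a b) (cong (λ k → suc (suc k + suc k)) (m+[n∸m]≡n (s≤s⁻¹ a<s))))
      where
      arith : ∀ a b → 1 + a + (1 + a) + (1 + b + b) ≡ 1 + (1 + (a + b) + (1 + (a + b)))
      arith = solve-∀

    -- Not being a `D` distinguishes this block from the one found for the odd difference.
    Even : Set
    Even = ∃ λ v → (∀ j r → D i j r ≢ v) × v ∈ₗ Tour × pt i x ∈ block v × pt i y ∈ block v

    centre : x ⊕ + suc a ⊕ + suc a ≡ y
    centre = trans (⊕-assoc x _ _) (sym y≡)

    in-U : ∀ ε → ε ≡ δ i → suc a < s → Even
    in-U Sign.+ eq 1+a<s = U i a (x ⊕ + suc a) , (λ _ _ ()) , U∈ i 1+a<s _ ,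
      ∈-cong (trans (cong (λ ε → x ⊕ + suc a ⊕ opposite ε · suc a) (sym eq)) (⊕-cancel Sign.+ x (suc a))) 1st ,
      ∈-cong (trans (cong (λ ε → x ⊕ + suc a ⊕ ε · suc a) (sym eq)) centre) 2nd
    in-U Sign.- eq 1+a<s = U i a (x ⊕ + suc a) , (λ _ _ ()) , U∈ i 1+a<s _ ,
      ∈-cong (trans (cong (λ ε → x ⊕ + suc a ⊕ ε · suc a) (sym eq)) (⊕-cancel Sign.+ x (suc a))) 2nd ,
      ∈-cong (trans (cong (λ ε → x ⊕ + suc a ⊕ opposite ε · suc a) (sym eq)) centre) 1st

    up∈E : ∀ {x r} → pt (next (previous i)) x ∈ block (E (previous i) r) → pt i x ∈ block (E (previous i) r)
    up∈E {x} {r} = subst (λ j → pt j x ∈ block (E (previous i) r)) (next-previous i)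

    in-E : ∀ ε → ε ≡ δ (previous i) → x ≡ y ⊕ + 1 → Even
    in-E Sign.+ eq x≡y+1 = E (previous i) y , (λ _ _ ()) , E∈ _ _ ,
      up∈E (∈-cong (trans (cong (λ ε → y ⊕ ε · 1) (sym eq)) (sym x≡y+1)) 3rd) , up∈E 2nd
    in-E Sign.- eq x≡y+1 = E (previous i) x , (λ _ _ ()) , E∈ _ _ ,
      up∈E 2nd , up∈E (∈-cong (trans (cong (λ ε → x ⊕ ε · 1) (sym eq)) (sym (⊕-move x≡y+1))) 3rd)

    even : Even
    even with m≤n⇒m<n∨m≡n a<s
    ... | inj₁ 1+a<s = in-U (δ i) refl 1+a<s
    -- Here `suc a` is `s`, and `y = x + 2s` means `x = y + 1`: the edge that an `E` of the previous
    -- level has on level `i`.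
    ... | inj₂ refl  = in-E (δ (previous i)) refl (complement y≡ (+-comm (s + s) 1))

    odd : ∀ ε → ε ≡ δ i → Twice (pt i x) (pt i y)
    odd Sign.+ eq with even
    ... | v , D≢v , v∈ , x∈ , y∈ = twice (D≢v b (y ⊕ + suc b)) (D∈ i b<s _) v∈
      (∈-cong (trans (cong (λ ε → y ⊕ + suc b ⊕ ε · b) (sym eq)) (trans (⊕-assoc y _ _) (sym x≡))) 1st)
      (∈-cong (trans (cong (λ ε → y ⊕ + suc b ⊕ opposite ε · suc b) (sym eq)) (⊕-cancel Sign.+ y (suc b))) 2nd)
      x∈ y∈
    odd Sign.- eq with even
    ... | v , D≢v , v∈ , x∈ , y∈ = twice (D≢v b (y ⊕ + b)) (D∈ i b<s _) v∈
      (∈-cong (trans (cong (λ ε → y ⊕ + b ⊕ opposite ε · suc b) (sym eq))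
        (trans (⊕-assoc y _ _) (trans (cong (λ k → y ⊕ + k) (+-suc b b)) (sym x≡)))) 2nd)
      (∈-cong (trans (cong (λ ε → y ⊕ + b ⊕ ε · b) (sym eq)) (⊕-cancel Sign.+ y b)) 1st)
      x∈ y∈

  signed-difference : ∀ ε x y → ∃ λ a → a ≤ s × (y ≡ x ⊕ ε · a ⊎ y ≡ x ⊕ opposite ε · a)
  signed-difference Sign.+ x y = centred-difference x y
  signed-difference Sign.- x y with centred-difference x y
  ... | a , a≤s , inj₁ y≡ = a , a≤s , inj₂ y≡
  ... | a , a≤s , inj₂ y≡ = a , a≤s , inj₁ y≡

  -- Modulo `2s + 1`, the offsets `-(s + 1)` and `s` agree.
  ⊕-antipode : ∀ ε r → r ⊕ opposite ε · 1 ⊕ opposite ε · s ≡ r ⊕ ε · s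
  ⊕-antipode ε r = trans (⊕-assoc r _ _) (wrap ε)
    where
    around : ∀ {a b} k → a ≡ b ℤ.+ k ℤ.* + t → r ⊕ a ≡ r ⊕ b
    around {b = b} k refl = trans (sym (⊕-assoc r b _)) (⊕-period (r ⊕ b) k)

    eq₊ : ∀ s → -1ℤ ℤ.+ - s ≡ s ℤ.+ -1ℤ ℤ.* (1ℤ ℤ.+ (s ℤ.+ s))
    eq₊ = solveℤ

    eq₋ : ∀ s → 1ℤ ℤ.+ s ≡ - s ℤ.+ 1ℤ ℤ.* (1ℤ ℤ.+ (s ℤ.+ s))
    eq₋ = solveℤ

    wrap : ∀ ε → r ⊕ (opposite ε · 1 ℤ.+ opposite ε · s) ≡ r ⊕ ε · s
    wrap Sign.+ = around -1ℤ (eq₊ (+ s))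
    wrap Sign.- = around 1ℤ (eq₋ (+ s))

  -- The cases follow the offset of `x` from the apex `z`. An inner vertex of the zigzag path lies
  -- on two of its edges; its start, offset 0, lies on one, and `O` supplies the second block.
  twice-mixed : ∀ i x z → Twice (pt i x) (pt (next i) z)
  twice-mixed i x z with signed-difference (δ i) z x
  ... | zero , _ , inj₁ refl = twice {u = O z} {D i 0 z} (λ ()) (O∈ z) (D∈ i (s≤s z≤n) z)
    (∈-cong (sym (⊕-0 (δ i) z)) (∈O i z)) (∈O (next i) z) 1st 3rd
  ... | zero , _ , inj₂ refl = twice {u = O z} {D i 0 z} (λ ()) (O∈ z) (D∈ i (s≤s z≤n) z)
    (∈-cong (sym (⊕-0 (opposite (δ i)) z)) (∈O i z)) (∈O (next i) z)
    (∈-cong (sym (⊕-0 (opposite (δ i)) z)) (centre∈D₀ i z)) 3rd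
  ... | suc a , a<s , inj₁ refl with m≤n⇒m<n∨m≡n a<s
  ...   | inj₁ 1+a<s = twice {u = U i a z} {D i (suc a) z} (λ ()) (U∈ i 1+a<s z) (D∈ i 1+a<s z) 2nd 3rd 1st 3rd
  -- At the far end of the path the flip removed the triangle with apex `z`; both blocks come from
  -- `r`, one step before `z` in the direction of `δ i`.
  ...   | inj₂ refl  = twice {u = E i r} {N i r} (λ ()) (E∈ i r) (N∈ i r)
    (∈-cong (⊕-antipode (δ i) z) 1st) (∈-cong (⊕-cancel′ (δ i) z 1) 3rd)
    (∈-cong (⊕-antipode (δ i) z) 2nd) (∈-cong (⊕-cancel′ (δ i) z 1) 3rd)
    where r = z ⊕ opposite (δ i) · 1
  twice-mixed i x z | suc a , a<s , inj₂ refl with m≤n⇒m<n∨m≡n a<s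
  ...   | inj₁ 1+a<s = twice {u = D i a z} {U i a z} (λ ()) (D∈ i a<s z) (U∈ i 1+a<s z) 2nd 3rd 1st 3rd
  ...   | inj₂ refl  = twice {u = D i a z} {E i z} (λ ()) (D∈ i a<s z) (E∈ i z) 2nd 3rd 1st 2nd

  twice-pt : ∀ i x j y → pt i x ≢ pt j y → Twice (pt i x) (pt j y)
  twice-pt i x j y p≢q with level-trichotomy i j
  ... | inj₂ (inj₁ refl) = twice-mixed i x y
  ... | inj₂ (inj₂ refl) = twice-sym (twice-mixed j y x)
  ... | inj₁ refl with even-difference x y (p≢q ∘ cong (pt i))
  ...   | a , 0<a , a≤s , inj₁ y≡ = twice-pure i x y a 0<a a≤s y≡
  ...   | a , 0<a , a≤s , inj₂ x≡ = twice-sym (twice-pure i y x a 0<a a≤s x≡)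

  twice-all : ∀ p q → p ≢ q → Twice p q
  twice-all p q p≢q with pt-surjective p | pt-surjective q
  ... | inj₁ refl           | inj₁ refl           = contradiction refl p≢q
  ... | inj₁ refl           | inj₂ (j , y , refl) = twice-∞ j y
  ... | inj₂ (i , x , refl) | inj₁ refl           = twice-sym (twice-∞ i x)
  ... | inj₂ (i , x , refl) | inj₂ (j , y , refl) = twice-pt i x j y p≢q

  -- The triple system and its Hamilton cycle.

  blocks : List (Subset (suc (3 * t)))
  blocks = List.map block Tour

  length-blocks : length blocks ≡ t * suc (3 * t)
  length-blocks = trans (length-map block Tour) (length-tour (s + s) zero)

  blocks-path : Path Linked (block (O zero)) (block (D 2F 0 zero)) blocks
  blocks-path = path-map block (λ l → l)
    (subst (λ x → Path Adjacent (O zero) (D 2F 0 x) Tour) wrap (tour-path (s + s) zero))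
    where
    eq : ∀ t → t ℤ.+ t ≡ + 2 ℤ.* t
    eq = solveℤ
    -- The `t` laps advance by `2t` in all, so the tour returns to its starting residue.
    wrap : zero ⊕ + (t + t) ≡ zero
    wrap = trans (cong (zero ⊕_) (eq (+ t))) (⊕-period zero (+ 2))

  hamiltonian : Σ (TTS (suc (3 * t))) λ T → Hamiltonian (2-BIG T)
  hamiltonian = closedPath⇒Hamiltonian blocks-path closing 3≤length (balanced⁺ (path-sizes blocks-path (size-D 2F zero (s≤s z≤n))) count covered)
    where
    closing : Linked (block (D 2F 0 zero)) (block (O zero))
    closing = linked-sym (O-D 2F zero)

    3≤length : 3 ≤ length blocks
    3≤length = ≤-trans (≤-trans (s≤s (s≤s (s≤s z≤n))) (m≤m+n (suc (3 * t)) ((s + s) * suc (3 * t)))) (≤-reflexive (sym length-blocks))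

    count : length blocks * 3 ≡ suc (3 * t) * (3 * t)
    count = trans (cong (_* 3) length-blocks) (arith t (suc (3 * t)))
      where
      arith : ∀ t n → t * n * 3 ≡ n * (3 * t)
      arith = solve-∀

    covered : ∀ p q → p ≢ q → 2 ≤ cover blocks p q
    covered p q p≢q with twice-all p q p≢q
    ... | twice u≢v u∈ v∈ pu qu pv qv = cover-≥2 block u≢v u∈ v∈ pu qu pv qv

theorem5p1 : (v : ℕ) →
    (∃ λ k → 1 ≤ k × v ≡ 6 * k + 1) ⊎ (∃ λ k → 2 ≤ k × v ≡ 6 * k + 4) →
    (Σ (TTS v) λ T → Hamiltonian (2-BIG T)) →
    Σ (TTS (2 * v + 2)) λ T → Hamiltonian (2-BIG T)
-- With `K = suc k`, `2v + 2 = 12K + 4 = 3(4K + 1) + 1`, so `s = 2K` and its predecessor is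
-- `k + suc k`.
theorem5p1 _ (inj₁ (suc k , _ , refl)) _ = subst (λ n → Σ (TTS n) λ T → Hamiltonian (2-BIG T)) (order k) (System.hamiltonian (k + suc k))
  where
  order : ∀ k → 1 + 3 * (1 + (1 + (k + (1 + k)) + (1 + (k + (1 + k))))) ≡ 2 * (6 * (1 + k) + 1) + 2
  order = solve-∀
-- Now `2v + 2 = 12k + 10 = 3(4k + 3) + 1`, so `s = 2k + 1` and its predecessor is `k + k`.
theorem5p1 _ (inj₂ (k , _ , refl)) _ = subst (λ n → Σ (TTS n) λ T → Hamiltonian (2-BIG T)) (order k) (System.hamiltonian (k + k))
  where
  order : ∀ k → 1 + 3 * (1 + (1 + (k + k) + (1 + (k + k)))) ≡ 2 * (6 * k + 4) + 2
  order = solve-∀
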